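{- Let $\mathcal T$ be the class of languages of standard session types and $\mathcal R$ the class of languages of session types with responses, i.e. $\mathcal T=\{\mathsf{str}(T)\mid T \text{ a standard session type}\}$ and $\mathcal R=\{\mathsf{str}_R(T)\mid T\text{ a session type with responses}\}$. Then session types with responses are strictly more expressive than standard session types: $\mathcal T\subsetneq\mathcal R$.
   Context: **Types.** Let $\mathcal L$ be a countably infinite set of labels; $l$ ranges over $\mathcal L$ and $L$ over subsets of $\mathcal L$. Session types with responses are given by $$S,T ::= \&\{l_i[L_i].T_i\}_{i\in I}\mid \oplus\{l_i[L_i].T_i\}_{i\in I}\mid\ !.T\mid\ ?.T\mid \mu t.T\mid t\mid \mathtt{end},$$ with $I$ finite and the labels $l_i$ in each branch ($\&$) or select ($\oplus$) distinct. Types are closed and contractive, and are taken equi-recursively: a type is identified with its (possibly infinite) tree unfolding. A type is a *standard* session type if every response set $L$ occurring in it is $\emptyset$. **Transitions of types.** Labels $\rho ::=\ !\mid\ ?\mid \&l[L]\mid\oplus l[L]$, and $!.T\xrightarrow{!}T$; $?.T\xrightarrow{?}T$; $\&\{l_i[L_i].T_i\}_{i\in I}\xrightarrow{\&l_i[L_i]}T_i$ and $\oplus\{l_i[L_i].T_i\}_{i\in I}\xrightarrow{\oplus l_i[L_i]}T_i$ for $i\in I$. **Responses.** $\mathsf{res}(!)=\mathsf{res}(?)=\emptyset$, $\mathsf{res}(\&l[L])=\mathsf{res}(\oplus l[L])=\{l\}$; $\mathsf{req}(!)=\mathsf{req}(?)=\emptyset$, $\mathsf{req}(\&l[L])=\mathsf{req}(\oplus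 l[L])=L$. For a finite or infinite sequence $\alpha$ of labels, $\mathsf{res}(\alpha)=\bigcup\{\mathsf{res}(\rho)\mid \rho\text{ occurs in }\alpha\}$. The sequence $\alpha$ is *live* iff whenever $\alpha=\varphi\,\rho\,\beta$ (with $\varphi$ finite, $\rho$ a single label), $\mathsf{req}(\rho)\subseteq\mathsf{res}(\beta)$. **Traces.** A transition sequence of $T$ is a finite sequence $T=T_1\xrightarrow{\rho_1}\cdots\xrightarrow{\rho_{n-1}}T_n$ ($n\ge 1$, not necessarily maximal) or an infinite sequence $T=T_1\xrightarrow{\rho_1}T_2\xrightarrow{\rho_2}\cdots$. $\mathsf{tr}(T)$ is the set of label sequences $\rho_1\rho_2\cdots$ of transition sequences of $T$, and $\mathsf{tr}_R(T)=\{\alpha\in\mathsf{tr}(T)\mid\alpha\text{ live}\}$. Put $\mathsf{sel}(!)=\mathsf{sel}(?)=\varepsilon$ (empty sequence), $\mathsf{sel}(\&l[L])=\mathsf{sel}(\oplus l[L])=l$, lifted pointwise (with concatenation) to finite and infinite sequences. Then $\mathsf{str}(T)=\{\mathsf{sel}(\alpha)\mid\alpha\in\mathsf{tr}(T)\}$ and $\mathsf{str}_R(T)=\{\mathsf{sel}(\alpha)\mid\alpha\in\mathsf{tr}_R(T)\}$. -}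

module Defs where

open import Level using (0ℓ; Lift) renaming (suc to lsuc)
open import Data.Nat.Base using (ℕ; zero; suc; _+_; _≤_)
open import Data.Fin.Base using (Fin; zero; suc; lift)
open import Data.List.Base using (List; []; _∷_; _++_; concatMap; applyUpTo)
open import Data.List.Membership.Propositional using () renaming (_∈_ to _∈ˡ_)
open import Data.Product.Base using (Σ-syntax; ∃-syntax; _×_; _,_)
open import Data.Unit.Base using (⊤)
open import Data.Empty using (⊥)
open import Function.Definitions using (Injective)
open import Relation.Nullary.Negation.Core using (¬_)
open import Relation.Binary.PropositionalEquality.Core using (_≡_)
open import Relation.Unary using (Pred; ∅; ｛_｝; _∈_; _⊆_; _≐_; Empty)

private variable
  A   : Set
  𝓛   : Set
  m n : ℕ

-- μ-terms with n free recursion variables (de Bruijn indices). A choice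
-- {lᵢ[Lᵢ].Tᵢ}_{i∈I} is indexed by I = Fin k, and k = 0 is allowed.  Response
-- sets are arbitrary subsets of 𝓛, not necessarily finite or decidable.
data Type (𝓛 : Set) (n : ℕ) : Set₁ where
  branch select : ∀ {k} (l : Fin k → 𝓛) → Injective _≡_ _≡_ l →
                  (L : Fin k → Pred 𝓛 0ℓ) (T : Fin k → Type 𝓛 n) → Type 𝓛 n
  send recv     : Type 𝓛 n → Type 𝓛 n
  μ             : Type 𝓛 (suc n) → Type 𝓛 n
  var           : Fin n → Type 𝓛 n
  end           : Type 𝓛 n

rename : (Fin m → Fin n) → Type 𝓛 m → Type 𝓛 n
rename r (branch l inj L T) = branch l inj L (λ i → rename r (T i))
rename r (select l inj L T) = select l inj L (λ i → rename r (T i))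
rename r (send T)           = send (rename r T)
rename r (recv T)           = recv (rename r T)
rename r (μ T)              = μ (rename (lift 1 r) T)
rename r (var x)            = var (r x)
rename r end                = end

extend : (Fin m → Type 𝓛 n) → Fin (suc m) → Type 𝓛 (suc n)
extend σ zero    = var zero
extend σ (suc x) = rename suc (σ x)

subst : (Fin m → Type 𝓛 n) → Type 𝓛 m → Type 𝓛 n
subst σ (branch l inj L T) = branch l inj L (λ i → subst σ (T i))
subst σ (select l inj L T) = select l inj L (λ i → subst σ (T i))
subst σ (send T)           = send (subst σ T)
subst σ (recv T)           = recv (subst σ T)
subst σ (μ T)              = μ (subst (extend σ) T)
subst σ (var x)            = σ x
subst σ end                = end

_[_] : Type 𝓛 (suc n) → Type 𝓛 n → Type 𝓛 n
T [ U ] = subst (λ { zero → U ; (suc x) → var x }) T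

-- Unguarded x T: T has the form μt₁.….μtₖ.x with x not among the tⱼ.
data Unguarded {𝓛 : Set} : {n : ℕ} → Fin n → Type 𝓛 n → Set₁ where
  var : {x : Fin n} → Unguarded x (var x)
  μ   : {x : Fin n} {T : Type 𝓛 (suc n)} → Unguarded (suc x) T → Unguarded x (μ T)

-- No subterm has the form μt.μt₁.….μtₖ.t.
Contractive : Type 𝓛 n → Set₁
Contractive (branch l inj L T) = ∀ i → Contractive (T i)
Contractive (select l inj L T) = ∀ i → Contractive (T i)
Contractive (send T)           = Contractive T
Contractive (recv T)           = Contractive T
Contractive (μ T)              = ¬ Unguarded zero T × Contractive T
Contractive (var x)            = Lift _ ⊤
Contractive end                = Lift _ ⊤

Standardᵗ : Type 𝓛 n → Set
Standardᵗ (branch l inj L T) = ∀ i → Empty (L i) × Standardᵗ (T i)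
Standardᵗ (select l inj L T) = ∀ i → Empty (L i) × Standardᵗ (T i)
Standardᵗ (send T)           = Standardᵗ T
Standardᵗ (recv T)           = Standardᵗ T
Standardᵗ (μ T)              = Standardᵗ T
Standardᵗ (var x)            = ⊤
Standardᵗ end                = ⊤

record SessionType (𝓛 : Set) : Set₁ where
  field
    term        : Type 𝓛 0
    contractive : Contractive term

open SessionType public

Standard : SessionType 𝓛 → Set
Standard S = Standardᵗ (term S)

data Action (𝓛 : Set) : Set₁ where
  !ₐ ?ₐ : Action 𝓛
  &ₐ ⊕ₐ : 𝓛 → Pred 𝓛 0ℓ → Action 𝓛

-- Types are equi-recursive: a μ-term has exactly the transitions of its
-- unfolding, so the traces below are those of its tree unfolding.
data _—[_]→_ {𝓛 : Set} : Type 𝓛 0 → Action 𝓛 → Type 𝓛 0 → Set₁ where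
  send   : ∀ {T} → send T —[ !ₐ ]→ T
  recv   : ∀ {T} → recv T —[ ?ₐ ]→ T
  branch : ∀ {k} {l : Fin k → 𝓛} {inj : Injective _≡_ _≡_ l} {L T} (i : Fin k) →
           branch l inj L T —[ &ₐ (l i) (L i) ]→ T i
  select : ∀ {k} {l : Fin k → 𝓛} {inj : Injective _≡_ _≡_ l} {L T} (i : Fin k) →
           select l inj L T —[ ⊕ₐ (l i) (L i) ]→ T i
  unfold : ∀ {T ρ U} → (T [ μ T ]) —[ ρ ]→ U → μ T —[ ρ ]→ U

data Seq {a} (A : Set a) : Set a where
  fin : List A → Seq A
  inf : (ℕ → A) → Seq A

_occursIn_ : ∀ {a} {A : Set a} → A → Seq A → Set a
x occursIn fin α = x ∈ˡ α
x occursIn inf α = ∃[ n ] α n ≡ x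

res : Action 𝓛 → Pred 𝓛 0ℓ
res !ₐ       = ∅
res ?ₐ       = ∅
res (&ₐ l L) = ｛ l ｝
res (⊕ₐ l L) = ｛ l ｝

req : Action 𝓛 → Pred 𝓛 0ℓ
req !ₐ       = ∅
req ?ₐ       = ∅
req (&ₐ l L) = L
req (⊕ₐ l L) = L

res* : Seq (Action 𝓛) → Pred 𝓛 (lsuc 0ℓ)
res* α l = ∃[ ρ ] ρ occursIn α × l ∈ res ρ

Live : Seq (Action 𝓛) → Set₁
Live (fin α) = ∀ φ ρ β → α ≡ φ ++ ρ ∷ β → req ρ ⊆ res* (fin β)
Live (inf α) = ∀ n → req (α n) ⊆ res* (inf (λ i → α (suc n + i)))

data FinTrace {𝓛 : Set} : Type 𝓛 0 → List (Action 𝓛) → Set₁ where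
  []  : ∀ {T} → FinTrace T []
  _∷_ : ∀ {T ρ U α} → T —[ ρ ]→ U → FinTrace U α → FinTrace T (ρ ∷ α)

InfTrace : Type 𝓛 0 → (ℕ → Action 𝓛) → Set₁
InfTrace {𝓛} T α = Σ[ Ts ∈ (ℕ → Type 𝓛 0) ]
                     Ts 0 ≡ T × (∀ n → Ts n —[ α n ]→ Ts (suc n))

tr : SessionType 𝓛 → Pred (Seq (Action 𝓛)) (lsuc 0ℓ)
tr S (fin α) = FinTrace (term S) α
tr S (inf α) = InfTrace (term S) α

trR : SessionType 𝓛 → Pred (Seq (Action 𝓛)) (lsuc 0ℓ)
trR S α = α ∈ tr S × Live α

sel : Action 𝓛 → List 𝓛
sel !ₐ       = []
sel ?ₐ       = []
sel (&ₐ l L) = l ∷ []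
sel (⊕ₐ l L) = l ∷ []

-- Sel α w: the concatenation of the words sel(ρ), for ρ along α, is w.
-- This is a relation because it is undecidable whether the concatenation
-- along an infinite α is finite.  Since each sel(ρ) has length at most one,
-- every finite prefix of the concatenation is attained at some prefix of α.
Sel : Seq (Action 𝓛) → Seq 𝓛 → Set
Sel (fin α) (fin w) = concatMap sel α ≡ w
Sel (fin α) (inf w) = ⊥
Sel (inf α) (fin w) = ∃[ n ] concatMap sel (applyUpTo α n) ≡ w ×
                             (∀ i → n ≤ i → sel (α i) ≡ [])
Sel (inf α) (inf w) = ∀ n → ∃[ k ] concatMap sel (applyUpTo α k) ≡ applyUpTo w n

Language : Set → Set₂
Language 𝓛 = Pred (Seq 𝓛) (lsuc 0ℓ)

str : SessionType 𝓛 → Language 𝓛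
str S w = ∃[ α ] α ∈ tr S × Sel α w

strR : SessionType 𝓛 → Language 𝓛
strR S w = ∃[ α ] α ∈ trR S × Sel α w

𝒯 : (𝓛 : Set) → Pred (Language 𝓛) (lsuc 0ℓ)
𝒯 𝓛 X = Σ[ S ∈ SessionType 𝓛 ] Standard S × X ≐ str S

ℛ : (𝓛 : Set) → Pred (Language 𝓛) (lsuc 0ℓ)
ℛ 𝓛 X = Σ[ S ∈ SessionType 𝓛 ] X ≐ strR S

{-# OPTIONS --safe #-}
-- Traces of a standard type request nothing, so all of them are live and
-- str(T) = str_R(T).  Conversely, the finite words of str(T) are closed under
-- prefixes, whereas str_R(&{a[{a}].&{a[∅].end}}) contains aa but not a.
module Submission where

open import Level using (0ℓ; lift)
open import Data.Nat.Base using (ℕ; zero; suc; _≤_; z≤n; s≤s)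
open import Data.Fin.Base using (Fin; zero; suc)
open import Data.List.Base using (List; []; _∷_; _++_; concatMap; applyUpTo; length)
open import Data.List.Properties using (∷-injective)
open import Data.List.Relation.Unary.All using (All; []; _∷_; head)
open import Data.List.Relation.Unary.All.Properties using (++⁻ʳ)
open import Data.List.Relation.Unary.Any using (here)
open import Data.Product.Base using (∃-syntax; _×_; _,_; proj₁; proj₂)
open import Data.Empty using (⊥-elim)
open import Data.Unit.Base using (tt)
open import Function.Base using (_∘_)
open import Function.Bundles using (_↔_; Inverse)
open import Relation.Binary.PropositionalEquality.Core using (_≡_; refl; cong₂)
open import Relation.Unary using (Pred; ∅; ｛_｝; _∈_; _∉_; _⊆_; _⊂_; _≐_; Empty)
open import Relation.Unary.Properties using (≐-refl; ≐-trans)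
open import Defs

private variable
  𝓛   : Set
  m n : ℕ

rename-standard : (r : Fin m → Fin n) (T : Type 𝓛 m) → Standardᵗ T → Standardᵗ (rename r T)
rename-standard r (branch l inj L T) s i = proj₁ (s i) , rename-standard r (T i) (proj₂ (s i))
rename-standard r (select l inj L T) s i = proj₁ (s i) , rename-standard r (T i) (proj₂ (s i))
rename-standard r (send T)           s   = rename-standard r T s
rename-standard r (recv T)           s   = rename-standard r T s
rename-standard r (μ T)              s   = rename-standard _ T s
rename-standard r (var x)            s   = tt
rename-standard r end                s   = tt

extend-standard : (σ : Fin m → Type 𝓛 n) → (∀ x → Standardᵗ (σ x)) → ∀ x → Standardᵗ (extend σ x)
extend-standard σ σ-std zero    = tt
extend-standard σ σ-std (suc x) = rename-standard suc (σ x) (σ-std x)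

subst-standard : (σ : Fin m → Type 𝓛 n) → (∀ x → Standardᵗ (σ x)) →
                 (T : Type 𝓛 m) → Standardᵗ T → Standardᵗ (subst σ T)
subst-standard σ σ-std (branch l inj L T) s i = proj₁ (s i) , subst-standard σ σ-std (T i) (proj₂ (s i))
subst-standard σ σ-std (select l inj L T) s i = proj₁ (s i) , subst-standard σ σ-std (T i) (proj₂ (s i))
subst-standard σ σ-std (send T)           s   = subst-standard σ σ-std T s
subst-standard σ σ-std (recv T)           s   = subst-standard σ σ-std T s
subst-standard σ σ-std (μ T)              s   = subst-standard _ (extend-standard σ σ-std) T s
subst-standard σ σ-std (var x)            s   = σ-std x
subst-standard σ σ-std end                s   = tt

-- The induction is on the derivation of the transition, because unfolding a recursive type can
-- enlarge the term.
step-standard : {T U : Type 𝓛 0} {ρ : Action 𝓛} →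
                T —[ ρ ]→ U → Standardᵗ T → Empty (req ρ) × Standardᵗ U
step-standard send                 s = (λ _ ()) , s
step-standard recv                 s = (λ _ ()) , s
step-standard (branch i)           s = s i
step-standard (select i)           s = s i
step-standard (unfold {T = T} T→U) s =
  -- The variable `zero` is replaced by `μ T` itself, whose standardness is again `s`.
  step-standard T→U (subst-standard _ (λ { zero → s ; (suc x) → tt }) T s)

finTrace-no-req : {T : Type 𝓛 0} {α : List (Action 𝓛)} →
                  FinTrace T α → Standardᵗ T → All (Empty ∘ req) α
finTrace-no-req []         s = []
finTrace-no-req (T→U ∷ tr) s with step-standard T→U s
... | no-req , s′ = no-req ∷ finTrace-no-req tr s′

infTrace-no-req : {T : Type 𝓛 0} {α : ℕ → Action 𝓛} →
                  InfTrace T α → Standardᵗ T → ∀ n → Empty (req (α n))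
infTrace-no-req (Ts , refl , step) s n = proj₁ (step-standard (step n) (Ts-standard n))
  where
  Ts-standard : ∀ n → Standardᵗ (Ts n)
  Ts-standard zero    = s
  Ts-standard (suc n) = proj₂ (step-standard (step n) (Ts-standard n))

standard-live : (S : SessionType 𝓛) → Standard S → tr S ⊆ Live
standard-live S s {fin α} t φ ρ β refl p =
  -- Dropping `φ` leaves `ρ` at the head, so `ρ` requests nothing, contrary to `p`.
  ⊥-elim (head (++⁻ʳ φ (finTrace-no-req t s)) _ p)
standard-live S s {inf α} t n p = ⊥-elim (infTrace-no-req t s n _ p)

str≐strR : (S : SessionType 𝓛) → Standard S → str S ≐ strR S
str≐strR S s = (λ (α , t , e) → α , (t , standard-live S s {α} t) , e)
             , (λ (α , (t , _) , e) → α , t , e)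

infTrace-prefix : {T : Type 𝓛 0} {α : ℕ → Action 𝓛} →
                  InfTrace T α → ∀ n → FinTrace T (applyUpTo α n)
infTrace-prefix t                  zero    = []
infTrace-prefix (Ts , refl , step) (suc n) =
  step 0 ∷ infTrace-prefix (Ts ∘ suc , refl , step ∘ suc) n

-- An infinite trace yields a finite word when it selects no label from some position `n` on;
-- cutting it at `n` loses nothing of the word.
finTrace-of-word : (S : SessionType 𝓛) {w : List 𝓛} → fin w ∈ str S →
                   ∃[ α ] FinTrace (term S) α × concatMap sel α ≡ w
finTrace-of-word S (fin α , t , e)           = α , t , e
finTrace-of-word S (inf α , t , n , e , _) = applyUpTo α n , infTrace-prefix t n , e

-- The trace is cut as soon as `w` is used up. No cut point is skipped, since an action contributes
-- at most one label; sends and receives are kept and leave `w` unchanged.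
finTrace-split : {T : Type 𝓛 0} {α : List (Action 𝓛)} (w {v} : List 𝓛) →
                 FinTrace T α → concatMap sel α ≡ w ++ v →
                 ∃[ β ] FinTrace T β × concatMap sel β ≡ w
finTrace-split []      t  e  = [] , [] , refl
finTrace-split (x ∷ w) [] ()
finTrace-split (x ∷ w) (_∷_ {ρ = !ₐ} T→U t) e with finTrace-split (x ∷ w) t e
... | β , t′ , e′ = !ₐ ∷ β , T→U ∷ t′ , e′
finTrace-split (x ∷ w) (_∷_ {ρ = ?ₐ} T→U t) e with finTrace-split (x ∷ w) t e
... | β , t′ , e′ = ?ₐ ∷ β , T→U ∷ t′ , e′
finTrace-split (x ∷ w) (_∷_ {ρ = &ₐ l L} T→U t) e with ∷-injective e
... | l≡x , e₁ with finTrace-split w t e₁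
... | β , t′ , e′ = &ₐ l L ∷ β , T→U ∷ t′ , cong₂ _∷_ l≡x e′
finTrace-split (x ∷ w) (_∷_ {ρ = ⊕ₐ l L} T→U t) e with ∷-injective e
... | l≡x , e₁ with finTrace-split w t e₁
... | β , t′ , e′ = ⊕ₐ l L ∷ β , T→U ∷ t′ , cong₂ _∷_ l≡x e′

str-prefix-closed : (S : SessionType 𝓛) (w {v} : List 𝓛) → fin (w ++ v) ∈ str S → fin w ∈ str S
str-prefix-closed S w p with finTrace-of-word S p
... | _ , t , e with finTrace-split w t e
... | β , t′ , e′ = fin β , t′ , e′

prefix : 𝓛 → Pred 𝓛 0ℓ → Type 𝓛 n → Type 𝓛 n
prefix a L T = branch {k = 1} (λ _ → a) (λ { {zero} {zero} _ → refl }) (λ _ → L) (λ _ → T)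

-- The first `a` requests a second one, so the live traces are the empty one and the complete one:
-- the language consists of the empty word and `aa`.
request-then-respond : 𝓛 → SessionType 𝓛
request-then-respond a = record
  { term        = prefix a ｛ a ｝ (prefix a ∅ end)
  ; contractive = λ _ _ → lift tt
  }

aa∈strR : (a : 𝓛) → fin (a ∷ a ∷ []) ∈ strR (request-then-respond a)
aa∈strR a = fin (&ₐ a ｛ a ｝ ∷ &ₐ a ∅ ∷ []) , (branch zero ∷ branch zero ∷ [] , live) , refl
  where
  live : Live (fin (&ₐ a ｛ a ｝ ∷ &ₐ a ∅ ∷ []))
  -- The second action answers the request of the first; at the next position the request set is
  -- empty.
  live []              ρ β refl refl = &ₐ a ∅ , here refl , refl
  live (_ ∷ [])        ρ β refl ()
  live (_ ∷ _ ∷ [])    ρ β ()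
  live (_ ∷ _ ∷ _ ∷ _) ρ β ()

length≤2 : (a : 𝓛) {α : List (Action 𝓛)} →
           FinTrace (term (request-then-respond a)) α → length α ≤ 2
length≤2 a []                               = z≤n
length≤2 a (branch zero ∷ [])               = s≤s z≤n
length≤2 a (branch zero ∷ branch zero ∷ []) = s≤s (s≤s z≤n)

-- The only trace with this word stops after the first action, with its request pending.
a∉strR : (a : 𝓛) → fin (a ∷ []) ∉ strR (request-then-respond a)
a∉strR a (fin _ , ([] , _) , ())
a∉strR a (fin _ , (branch zero ∷ [] , live) , _) with live [] _ [] refl refl
... | _ , () , _
a∉strR a (fin _ , (branch zero ∷ branch zero ∷ [] , _) , ())
-- An infinite trace would have a prefix of length 3, one more than the type allows.
a∉strR a (inf _ , (t , _) , _) with length≤2 a (infTrace-prefix t 3)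
... | s≤s (s≤s ())

𝒯⊆ℛ : 𝒯 𝓛 ⊆ ℛ 𝓛
𝒯⊆ℛ (S , s , X≐str) = S , ≐-trans X≐str (str≐strR S s)

-- Were the language that of a standard `S`, prefix closure of `str S` would carry membership from
-- `aa` to `a`.
strR∉𝒯 : (a : 𝓛) → strR (request-then-respond a) ∉ 𝒯 𝓛
strR∉𝒯 a (S , _ , strR⊆str , str⊆strR) =
  a∉strR a (str⊆strR (str-prefix-closed S (a ∷ []) (strR⊆str (aa∈strR a))))

theorem3p10 : (𝓛 : Set) → (ℕ ↔ 𝓛) → 𝒯 𝓛 ⊂ ℛ 𝓛
theorem3p10 𝓛 ℕ↔𝓛 = 𝒯⊆ℛ , λ ℛ⊆𝒯 → strR∉𝒯 a (ℛ⊆𝒯 (request-then-respond a , ≐-refl))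
  where
  a : 𝓛
  a = Inverse.to ℕ↔𝓛 0
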